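{- There exists an absolute constant $C>0$ such that for every positive integer $t$ and every finite graph $G$ of treewidth at most $t$, the hypergraph of balls in $G$ has a proper sample compression scheme of size at most $C\,t\log(t+1)$ (i.e. of size $\mathcal{O}(t\log t)$).
   Context: A hypergraph $H$ is a pair $(V(H),E(H))$ with $V(H)$ a finite set and $E(H)$ a set of subsets of $V(H)$ (hyperedges). A sample of $H$ is a pair $(X^+,X^-)$ of subsets of $V(H)$ such that some $e\in E(H)$ satisfies $X^+\subseteq e$ and $X^-\cap e=\emptyset$; $\mathcal{S}(H)$ is the set of samples. A set $S\subseteq V(H)$ realizes $(X^+,X^-)$ if $X^+\subseteq S$ and $S\cap X^-=\emptyset$. $(Y^+,Y^-)$ is a subsample of $(X^+,X^-)$ if $Y^+\subseteq X^+$, $Y^-\subseteq X^-$; the size of a sample is $|X^+\cup X^-|$. A sample compression scheme of $H$ is a pair $(\kappa,\rho)$ with $\kappa:\mathcal{S}(H)\to\mathcal{S}(H)\times\{0,1\}^*$ and $\rho:\mathcal{S}(H)\times\{0,1\}^*\to 2^{V(H)}$ such that for every sample $(X^+,X^-)$, writing $\kappa(X^+,X^-)=(\kappa_1,\kappa_2)$, $\kappa_1$ is a subsample of $(X^+,X^-)$ and $\rho(\kappa(X^+,X^-))$ realizes $(X^+,X^-)$. Its size is $k_1+k_2$, where $k_1$ is the maximum size of $\kappa_1(X^+,X^-)$ and $k_2$ the maximum length of the bitstring $\kappa_2(X^+,X^-)$ over all samples. It is proper if all values of $\rho$ lie in $E(H)$. For a graph $G$, $\mathrm{dist}_G(u,v)$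 is the number of edges of a shortest $u$-$v$ path ($\infty$ if none), and for $c\in V(G)$ and an integer $r$, $B_G(c,r)=\{v\in V(G):\mathrm{dist}_G(c,v)\le r\}$. The hypergraph of balls in $G$ has vertex set $V(G)$ and hyperedges all $B_G(c,r)$ for $c\in V(G)$ and integers $r$. Treewidth is the usual notion: minimum over tree decompositions $(T,(W_x)_{x\in V(T)})$ of $\max|W_x|-1$. -}

module Defs where

open import Data.Bool.Base using (Bool)
open import Data.Fin.Base using (Fin)
open import Data.Fin.Subset using (Subset; _∈_; _⊆_; _∩_; _∪_; ∣_∣; Empty)
open import Data.Integer.Base as ℤ using (ℤ; +_)
open import Data.List.Base as List using (List; []; _∷_)
open import Data.List.Relation.Unary.All using (All)
open import Data.List.Relation.Unary.Unique.Propositional using (Unique)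
open import Data.Nat.Base using (ℕ; zero; suc; _+_; _≤_; NonZero)
open import Data.Product.Base using (Σ; ∃-syntax; _×_; proj₁; proj₂)
open import Function.Bundles using (_⇔_)
open import Level using (0ℓ)
open import Relation.Binary.Core using (Rel)
open import Relation.Binary.Definitions using (Decidable; Irreflexive; Symmetric)
open import Relation.Binary.PropositionalEquality.Core using (_≡_)
open import Relation.Nullary.Negation.Core using (¬_)
open import Relation.Unary using (Pred)

------------------------------------------------------------------------
-- Hypergraphs and sample compression schemes

-- A hypergraph with vertex set Fin n, given by its set of hyperedges.
Hypergraph : ℕ → Set₁
Hypergraph n = Pred (Subset n) 0ℓ

Realizes : ∀ {n} → Subset n → Subset n → Subset n → Set
Realizes S X⁺ X⁻ = X⁺ ⊆ S × Empty (S ∩ X⁻)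

-- The witnessing hyperedge is irrelevant, so that a sample is nothing more
-- than a pair of sets: otherwise a compression map could smuggle the
-- hyperedge to the reconstruction map inside an empty sample.
record Sample {n} (H : Hypergraph n) : Set where
  constructor sample
  field
    pos neg     : Subset n
    .realizable : ∃[ e ] H e × Realizes e pos neg

open Sample public using (pos; neg)

module _ {n} {H : Hypergraph n} where

  infix 4 _⊑_

  _⊑_ : Sample H → Sample H → Set
  Y ⊑ X = pos Y ⊆ pos X × neg Y ⊆ neg X

  sampleSize : Sample H → ℕ
  sampleSize X = ∣ pos X ∪ neg X ∣

record CompressionScheme {n} (H : Hypergraph n) : Set where
  field
    κ         : Sample H → Sample H × List Bool
    ρ         : Sample H × List Bool → Subset n
    subsample : ∀ X → proj₁ (κ X) ⊑ X
    realizes  : ∀ X → Realizes (ρ (κ X)) (pos X) (neg X)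

module _ {n} {H : Hypergraph n} (𝒞 : CompressionScheme H) where

  open CompressionScheme 𝒞

  -- The size is a sum of two separate maxima over all samples; it is at most
  -- s exactly when these have upper bounds k₁ and k₂ with k₁ + k₂ ≤ s.
  SizeAtMost : ℕ → Set
  SizeAtMost s = ∃[ k₁ ] ∃[ k₂ ]
    (∀ X → sampleSize (proj₁ (κ X)) ≤ k₁) ×
    (∀ X → List.length (proj₂ (κ X)) ≤ k₂) ×
    k₁ + k₂ ≤ s

  Proper : Set
  Proper = ∀ z → H (ρ z)

------------------------------------------------------------------------
-- Graphs

-- Adjacency is decidable because graphs are classical finite objects.
record Graph (n : ℕ) : Set₁ where
  field
    Adj    : Rel (Fin n) 0ℓ
    adj?   : Decidable Adj
    symm   : Symmetric Adj
    irrefl : Irreflexive _≡_ Adj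

module _ {n} (G : Graph n) where

  open Graph G

  infixr 5 _∷_

  data Walk : Fin n → Fin n → Set where
    []  : ∀ {u} → Walk u u
    _∷_ : ∀ {u v w} → Adj u v → Walk v w → Walk u w

module _ {n} {G : Graph n} where

  length : ∀ {u v} → Walk G u v → ℕ
  length []      = zero
  length (_ ∷ p) = suc (length p)

  vertices : ∀ {u v} → Walk G u v → List (Fin n)
  vertices {u} []      = u ∷ []
  vertices {u} (_ ∷ p) = u ∷ vertices p

  IsPath : ∀ {u v} → Walk G u v → Set
  IsPath p = Unique (vertices p)

module _ {n} (G : Graph n) where

  open Graph G

  Path : Fin n → Fin n → Set
  Path u v = Σ (Walk G u v) IsPath

  -- dist(u,v) = d < ∞.  The value ∞ corresponds to no d being related.
  Dist : Fin n → Fin n → ℕ → Set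
  Dist u v d =
    (Σ (Path u v) λ p → length (proj₁ p) ≡ d) ×
    (∀ (p : Path u v) → d ≤ length (proj₁ p))

  IsBall : Fin n → ℤ → Subset n → Set
  IsBall c r S = ∀ v → v ∈ S ⇔ (∃[ d ] Dist c v d × + d ℤ.≤ r)

  balls : Hypergraph n
  balls S = ∃[ c ] ∃[ r ] IsBall c r S

  Connected : Set
  Connected = ∀ u v → Walk G u v

  -- A cycle is a path of length at least 2 closed up by one further edge.
  Cycle : Set
  Cycle = ∃[ u ] ∃[ v ] Adj u v × Σ (Path v u) λ p → 2 ≤ length (proj₁ p)

  record IsTree : Set where
    field
      nonEmpty  : NonZero n
      connected : Connected
      acyclic   : ¬ Cycle

record TreeDecomposition {n} (G : Graph n) : Set₁ where
  open Graph G
  field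
    {m}         : ℕ
    T           : Graph m
    isTree      : IsTree T
    bag         : Fin m → Subset n
    coverVertex : ∀ v → ∃[ x ] v ∈ bag x
    coverEdge   : ∀ {u v} → Adj u v → ∃[ x ] u ∈ bag x × v ∈ bag x
    -- The nodes whose bag contains v induce a connected subgraph of T.
    coherent    : ∀ {v x y} → v ∈ bag x → v ∈ bag y →
                  Σ (Walk T x y) λ p → All (λ z → v ∈ bag z) (vertices p)

-- Stated as ∣ bag x ∣ ≤ t + 1 since ∣ bag x ∣ - 1 may be negative.
TreewidthAtMost : ∀ {n} → Graph n → ℕ → Set₁
TreewidthAtMost G t =
  Σ (TreeDecomposition G) λ D →
    ∀ x → ∣ TreeDecomposition.bag D x ∣ ≤ suc t

{-# OPTIONS --safe #-}

-- A tree decomposition is turned into a binary recursive separation of the graph.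
-- The lca's of the sample points split the decomposition tree into regions, each
-- bounded by at most two of the lca's and free of sample points in its interior.
-- So the region of the centre c can be named by at most four sample points, and
-- the at most 2(t + 1) vertices w of the two bounding bags separate c from the
-- sample.  For each such w keep the farthest positive point p with
-- d(c,w) + d(w,p) ≤ r, and the nearest negative point q.  Any ball B(c′,r′) with
-- c′ in the region, d(c′,w) + d(w,p) ≤ r′ for all w, and containing no kept
-- negative point then realizes the whole sample: positive points are reached from
-- c, and negative ones from c′, through some w.  The t log t bits tell which kept
-- point plays the role of p for which w.

module Submission where

open import Defs
open import Data.Nat.Base using (ℕ; _+_; _*_; _≤_; _<_)
open import Data.Nat.Logarithm using (⌊log₂_⌋)
open import Data.Product.Base using (Σ; ∃-syntax; _×_)
open import Data.Bool.Base using (Bool; true; false; if_then_else_)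
open import Data.Empty using (⊥-elim-irr)
open import Data.Fin.Base using (Fin; zero; suc; toℕ; fromℕ<)
open import Data.Fin.Properties using (_≟_; all?; any?; injective⇒≤; toℕ<n; toℕ-fromℕ<)
open import Data.Fin.Subset using (Subset; inside; outside; _∈_; _∉_; _⊆_; _⊂_; _∪_; _∩_; ∣_∣; ⊥; ⊤; ⁅_⁆; ∁; ⋃)
open import Data.Fin.Subset.Induction using (⊂-wellFounded)
open import Data.Fin.Subset.Properties using (_∈?_; nonempty?; ∉⊥; ∈⊤; x∈⁅x⁆; x∈⁅y⁆⇒x≡y; x∈∁p⇒x∉p; x∉p⇒x∈∁p; x∈p∩q⁺; x∈p∩q⁻; x∈p∪q⁺; x∈p∪q⁻; p∩q⊆p; p∩q⊆q; p⊆p∪q; q⊆p∪q; p⊆q⇒∣p∣≤∣q∣; ∣⊥∣≡0; ∣⁅x⁆∣≡1)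
open import Data.Integer.Base as ℤ using (+_; -[1+_])
open import Data.List.Base as List using (List; []; _∷_; _++_; catMaybes; filter; zip)
import Data.List.Membership.DecPropositional as DecMembership
open import Data.List.Membership.Propositional using (find) renaming (_∈_ to _∈ˡ_; _∉_ to _∉ˡ_)
open import Data.List.Membership.Propositional.Properties using (∈-map⁺; ∈-map⁻; ∈-lookup; ∈-++⁺ˡ; ∈-++⁺ʳ; ∈-filter⁺; ∈-filter⁻)
open import Data.List.Properties using (length-map; length-++; length-catMaybes; ++-identityʳ)
open import Data.List.Relation.Unary.All as All using (All; []; _∷_)
open import Data.List.Relation.Unary.All.Properties using (¬Any⇒All¬; ¬All⇒Any¬; ++⁺; map⁺)
open import Data.List.Relation.Unary.AllPairs using ([]; _∷_)
open import Data.List.Relation.Unary.Any as Any using (here; there)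
open import Data.List.Relation.Unary.Unique.Propositional using (Unique)
open import Data.Maybe.Base using (Maybe; just; nothing)
open import Data.Maybe.Relation.Unary.All as Maybe using (just; nothing)
open import Data.Nat.Base using (zero; suc; _∸_; _^_; _⊓_; z≤n; s≤s; s≤s⁻¹; >-nonZero⁻¹)
open import Data.Nat.Logarithm using (⌊log₂⌋-mono-≤; ⌊log₂[2^n]⌋≡n)
open import Data.Nat.Properties using (_≤?_; _<?_; ≤-refl; ≤-reflexive; ≤-trans; ≤-antisym; ≤-total; ≤-<-trans; <-≤-trans; <-irrefl; <⇒≤; ≰⇒>; ≮⇒≥; n≤1+n; m≤n⇒m≤1+n; m≤m+n; m≤n+m; +-suc; +-identityʳ; +-mono-≤; +-monoˡ-≤; +-monoʳ-≤; +-cancelˡ-<; *-monoˡ-≤; *-monoʳ-≤; ^-distribˡ-+-*; m+[n∸m]≡n; m⊓n≤m; m⊓n≤n; ⊓-glb; module ≤-Reasoning)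
open import Data.Nat.Tactic.RingSolver using (solve-∀)
open import Data.Product.Base using (_,_; proj₁; proj₂)
open import Data.Sum.Base using (_⊎_; inj₁; inj₂)
open import Data.Vec.Base as Vec using ([]; _∷_; tabulate; here; there)
open import Data.Vec.Properties using (lookup∘tabulate; lookup⇒[]=; []=⇒lookup)
open import Function.Base using (_∘_; id; case_of_)
open import Function.Bundles using (mk⇔; module Equivalence)
open import Induction.WellFounded using (Acc; acc)
open import Level using (0ℓ)
open import Relation.Binary.Core using (Rel)
open import Relation.Binary.Definitions using (Total; Transitive)
open import Relation.Binary.PropositionalEquality using (_≡_; _≢_; refl; sym; trans; cong; cong₂; subst)
open import Relation.Nullary using (¬_; Dec; yes; no; does; contradiction)
open import Relation.Nullary.Decidable using (map′; _×-dec_; _⊎-dec_; _→-dec_; ¬?; dec-true)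
open import Relation.Unary using (Pred; Decidable)

-- Walks, distances and balls

module _ {n : ℕ} where
  open DecMembership (_≟_ {n}) public using () renaming (_∈?_ to _∈ˡ?_)

comprehension : ∀ {n} {P : Pred (Fin n) 0ℓ} → Decidable P → Subset n
comprehension P? = tabulate (does ∘ P?)

∈-comprehension⁺ : ∀ {n} {P : Pred (Fin n) 0ℓ} (P? : Decidable P) {x} → P x → x ∈ comprehension P?
∈-comprehension⁺ P? {x} px =
  lookup⇒[]= x _ (trans (lookup∘tabulate (does ∘ P?) x) (dec-true (P? x) px))

∈-comprehension⁻ : ∀ {n} {P : Pred (Fin n) 0ℓ} (P? : Decidable P) {x} → x ∈ comprehension P? → P x
∈-comprehension⁻ P? {x} x∈ with P? x | trans (sym (lookup∘tabulate (does ∘ P?) x)) ([]=⇒lookup x∈)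
... | yes px | _  = px
... | no _   | ()

elements : ∀ {n} → Subset n → List (Fin n)
elements []            = []
elements (inside  ∷ p) = zero ∷ List.map suc (elements p)
elements (outside ∷ p) = List.map suc (elements p)

length-elements : ∀ {n} (p : Subset n) → List.length (elements p) ≡ ∣ p ∣
length-elements []            = refl
length-elements (inside  ∷ p) = cong suc (trans (length-map suc (elements p)) (length-elements p))
length-elements (outside ∷ p) = trans (length-map suc (elements p)) (length-elements p)

∈-elements⁺ : ∀ {n} {p : Subset n} {x} → x ∈ p → x ∈ˡ elements p
∈-elements⁺ {p = inside  ∷ p} here       = here refl
∈-elements⁺ {p = inside  ∷ p} (there x∈) = there (∈-map⁺ suc (∈-elements⁺ x∈))
∈-elements⁺ {p = outside ∷ p} (there x∈) = ∈-map⁺ suc (∈-elements⁺ x∈)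

∈-elements⁻ : ∀ {n} (p : Subset n) {x} → x ∈ˡ elements p → x ∈ p
∈-elements⁻ (inside  ∷ p) (here refl) = here
∈-elements⁻ (inside  ∷ p) (there x∈) with ∈-map⁻ suc x∈
... | _ , y∈ , refl = there (∈-elements⁻ p y∈)
∈-elements⁻ (outside ∷ p) x∈ with ∈-map⁻ suc x∈
... | _ , y∈ , refl = there (∈-elements⁻ p y∈)

lookup-unique-injective : ∀ {A : Set} {xs : List A} → Unique xs → ∀ {i j} →
  List.lookup xs i ≡ List.lookup xs j → i ≡ j
lookup-unique-injective (_  ∷ _)  {zero}  {zero}  _  = refl
lookup-unique-injective (x∉ ∷ _)  {zero}  {suc j} eq = contradiction eq (All.lookup x∉ (∈-lookup j))
lookup-unique-injective (x∉ ∷ _)  {suc i} {zero}  eq = contradiction (sym eq) (All.lookup x∉ (∈-lookup i))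
lookup-unique-injective (_  ∷ xs!) {suc i} {suc j} eq = cong suc (lookup-unique-injective xs! eq)

unique⇒length≤ : ∀ {n} {xs : List (Fin n)} → Unique xs → List.length xs ≤ n
unique⇒length≤ xs! = injective⇒≤ (lookup-unique-injective xs!)

-- The value is k if no i < k satisfies P.
least : {P : Pred ℕ 0ℓ} → Decidable P → ℕ → ℕ
least P? zero    = zero
least P? (suc k) with P? zero
... | yes _ = zero
... | no  _ = suc (least (P? ∘ suc) k)

least≤bound : ∀ {P : Pred ℕ 0ℓ} (P? : Decidable P) k → least P? k ≤ k
least≤bound P? zero    = z≤n
least≤bound P? (suc k) with P? zero
... | yes _ = z≤n
... | no  _ = s≤s (least≤bound (P? ∘ suc) k)

least-satisfies : ∀ {P : Pred ℕ 0ℓ} (P? : Decidable P) k → least P? k < k → P (least P? k)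
least-satisfies P? (suc k) l<k with P? zero
... | yes p = p
... | no  _ = least-satisfies (P? ∘ suc) k (s≤s⁻¹ l<k)

least-minimal : ∀ {P : Pred ℕ 0ℓ} (P? : Decidable P) k {i} → P i → least P? k ≤ i
least-minimal P? zero    _ = z≤n
least-minimal P? (suc k) {i} pi with P? zero
... | yes _ = z≤n
least-minimal P? (suc k) {zero}  pi | no ¬p = contradiction pi ¬p
least-minimal P? (suc k) {suc i} pi | no _  = s≤s (least-minimal (P? ∘ suc) k pi)

module _ {n : ℕ} {G : Graph n} where
  open Graph G

  _++ʷ_ : ∀ {u v w} → Walk G u v → Walk G v w → Walk G u w
  []      ++ʷ q = q
  (e ∷ p) ++ʷ q = e ∷ (p ++ʷ q)

  length-++ʷ : ∀ {u v w} (p : Walk G u v) (q : Walk G v w) → length (p ++ʷ q) ≡ length p + length q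
  length-++ʷ []      q = refl
  length-++ʷ (e ∷ p) q = cong suc (length-++ʷ p q)

  length-vertices : ∀ {u v} (p : Walk G u v) → List.length (vertices p) ≡ suc (length p)
  length-vertices []      = refl
  length-vertices (_ ∷ p) = cong suc (length-vertices p)

  path-length< : ∀ {u v} (p : Walk G u v) → IsPath p → length p < n
  path-length< p p! = subst (_≤ n) (length-vertices p) (unique⇒length≤ p!)

  suffix : ∀ {u v w} (p : Walk G u v) → IsPath p → w ∈ˡ vertices p →
           Σ (Walk G w v) λ q → IsPath q × length q ≤ length p
  suffix []      p!       (here refl) = [] , p! , z≤n
  suffix (e ∷ p) p!       (here refl) = e ∷ p , p! , ≤-refl
  suffix (e ∷ p) (_ ∷ p!) (there w∈) with suffix p p! w∈
  ... | q , q! , q≤p = q , q! , m≤n⇒m≤1+n q≤p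

  walk⇒path : ∀ {u v} (p : Walk G u v) → Σ (Walk G u v) λ q → IsPath q × length q ≤ length p
  walk⇒path []              = [] , [] ∷ [] , z≤n
  walk⇒path {u} (e ∷ p) with walk⇒path p
  ... | q , q! , q≤p with u ∈ˡ? vertices q
  ...   | no  u∉ = e ∷ q , ¬Any⇒All¬ _ u∉ ∷ q! , s≤s q≤p
  ...   | yes u∈ with suffix q q! u∈
  ...     | r , r! , r≤q = r , r! , m≤n⇒m≤1+n (≤-trans r≤q q≤p)

module _ {n : ℕ} (G : Graph n) where
  open Graph G

  Within : ℕ → Fin n → Fin n → Set
  Within k u v = Σ (Walk G u v) λ p → length p ≤ k

  within? : ∀ k u v → Dec (Within k u v)
  within? zero u v = map′ (λ { refl → [] , z≤n }) (λ { ([] , _) → refl }) (u ≟ v)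
  within? (suc k) u v =
    map′ (λ { (inj₁ refl) → [] , z≤n ; (inj₂ (w , e , p , p≤)) → e ∷ p , s≤s p≤ })
         (λ { ([] , _) → inj₁ refl ; (e ∷ p , s≤s p≤) → inj₂ (_ , e , p , p≤) })
         (u ≟ v ⊎-dec any? (λ w → adj? u w ×-dec within? k w v))

  walk? : ∀ u v → Dec (Walk G u v)
  -- Every walk shortens to a path, whose length is below `n`, so searching lengths up to `n`
  -- decides reachability.
  walk? u v = map′ proj₁ shorten (within? n u v)
    where
    shorten : Walk G u v → Within n u v
    shorten p with walk⇒path p
    ... | q , q! , _ = q , <⇒≤ (path-length< q q!)

  -- Unreachable pairs get the value n + 1, for which the triangle inequality
  -- persists.
  dist : Fin n → Fin n → ℕ
  dist u v = least (λ k → within? k u v) (suc n)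

  dist≤1+n : ∀ u v → dist u v ≤ suc n
  dist≤1+n u v = least≤bound (λ k → within? k u v) (suc n)

  dist⇒within : ∀ {u v} → dist u v < suc n → Within (dist u v) u v
  dist⇒within {u} {v} = least-satisfies (λ k → within? k u v) (suc n)

  walk⇒dist≤ : ∀ {u v} (p : Walk G u v) → dist u v ≤ length p
  walk⇒dist≤ {u} {v} p = least-minimal (λ k → within? k u v) (suc n) (p , ≤-refl)

  dist-triangle : ∀ u w v → dist u v ≤ dist u w + dist w v
  dist-triangle u w v with dist u w <? suc n | dist w v <? suc n
  ... | no uw≮ | _ = ≤-trans (dist≤1+n u v) (≤-trans (≮⇒≥ uw≮) (m≤m+n _ _))
  ... | yes _  | no wv≮ = ≤-trans (dist≤1+n u v) (≤-trans (≮⇒≥ wv≮) (m≤n+m _ _))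
  ... | yes uw | yes wv with dist⇒within uw | dist⇒within wv
  ...   | p , p≤ | q , q≤ =
    ≤-trans (walk⇒dist≤ (p ++ʷ q)) (≤-trans (≤-reflexive (length-++ʷ p q)) (+-mono-≤ p≤ q≤))

  -- Radii are shifted by one, so that k = 0 gives the empty ball.
  ball : Fin n → ℕ → Subset n
  ball c k = comprehension (λ v → dist c v <? k)

  -- `Dist` minimises over paths and `dist` over walks; shortening a walk to a path makes the two
  -- minima agree.
  Dist⇒≡dist : ∀ {c v d} → Dist G c v d → d ≡ dist c v × d < n
  Dist⇒≡dist {c} {v} (((p , p!) , refl) , shortest) =
    ≤-antisym
      (let q , q≤ = dist⇒within (≤-<-trans (walk⇒dist≤ p) (m≤n⇒m≤1+n (path-length< p p!)))
           r , r! , r≤q = walk⇒path q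
       in ≤-trans (shortest (r , r!)) (≤-trans r≤q q≤))
      (walk⇒dist≤ p)
    , path-length< p p!

  dist⇒Dist : ∀ {c v} → dist c v < suc n → Dist G c v (dist c v)
  dist⇒Dist {c} {v} d< =
    let q , q≤ = dist⇒within d<
        r , r! , r≤q = walk⇒path q
    in ((r , r!) , ≤-antisym (≤-trans r≤q q≤) (walk⇒dist≤ r)) , λ p → walk⇒dist≤ (proj₁ p)

  -- Because `k ≤ suc n`, the value `suc n` of an unreachable pair is never below `k`, so membership
  -- forces a genuine distance. The case `k = 0` takes radius -1.
  ball-isBall : ∀ c {k} → k ≤ suc n → balls G (ball c k)
  ball-isBall c {zero} _ = c , -[1+ 0 ] , λ v →
    mk⇔ (λ v∈ → contradiction (∈-comprehension⁻ (λ v → dist c v <? 0) {v} v∈) (λ ()))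
        (λ { (_ , _ , ()) })
  ball-isBall c {suc k} k≤ = c , + k , λ v →
    mk⇔ (λ v∈ → let d<k = ∈-comprehension⁻ (λ v → dist c v <? suc k) {v} v∈ in
                 dist c v , dist⇒Dist (<-≤-trans d<k k≤) , ℤ.+≤+ (s≤s⁻¹ d<k))
        (λ { (d , isDist , ℤ.+≤+ d≤k) → ∈-comprehension⁺ (λ v → dist c v <? suc k)
               (s≤s (subst (_≤ k) (proj₁ (Dist⇒≡dist isDist)) d≤k)) })

  Separates : (c : Fin n) (k : ℕ) → Subset n → Subset n → Set
  Separates c k P N = (∀ {v} → v ∈ P → dist c v < k) × (∀ {v} → v ∈ N → ¬ dist c v < k)

  separates⇒realizes : ∀ {c k P N} → Separates c k P N → Realizes (ball c k) P N
  separates⇒realizes {c} {k} {P} {N} (near , far) =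
    (λ v∈P → ∈-comprehension⁺ (λ v → dist c v <? k) (near v∈P))
    , λ (v , v∈) → let v∈ball , v∈N = x∈p∩q⁻ (ball c k) N v∈ in
        far v∈N (∈-comprehension⁻ (λ v → dist c v <? k) {v} v∈ball)

  -- Integer radii beyond this range give no further balls, since path lengths are below `n`; the
  -- search for a separating ball is therefore finite.
  Separable : Subset n → Subset n → Set
  Separable P N = ∃[ c ] Σ (Fin (suc (suc n))) λ k → Separates c (toℕ k) P N

  separable? : ∀ P N → Dec (Separable P N)
  separable? P N = any? λ c → any? λ k →
    map′ (λ f {v} → f v) (λ f v → f) (all? λ v → (v ∈? P) →-dec (dist c v <? toℕ k))
    ×-dec
    map′ (λ f {v} → f v) (λ f v → f) (all? λ v → (v ∈? N) →-dec ¬? (dist c v <? toℕ k))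

  realizable⇒separable : ∀ {P N} → ∃[ e ] balls G e × Realizes e P N → Separable P N
  realizable⇒separable (e , (c , -[1+ m ] , isBall) , P⊆e , e∩N) =
    c , zero
    , (λ {v} v∈P → let _ , _ , ≤r = to (isBall v) (P⊆e v∈P) in contradiction ≤r λ ())
    , λ _ ()
    where open Equivalence
  realizable⇒separable {P} {N} (e , (c , + m , isBall) , P⊆e , e∩N) =
    c , fromℕ< k< , subst (λ k → Separates c k P N) (sym (toℕ-fromℕ< k<)) (near , far)
    where
    open Equivalence
    -- Capping the radius at `n` loses no reachable vertex and keeps the unreachable ones, at value
    -- `suc n`, outside.
    k< : suc (m ⊓ n) < suc (suc n)
    k< = s≤s (s≤s (m⊓n≤n m n))
    near : ∀ {v} → v ∈ P → dist c v < suc (m ⊓ n)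
    near {v} v∈P with to (isBall v) (P⊆e v∈P)
    ... | d , isDist , ℤ.+≤+ d≤m with Dist⇒≡dist isDist
    ...   | refl , d<n = s≤s (⊓-glb d≤m (<⇒≤ d<n))
    far : ∀ {v} → v ∈ N → ¬ dist c v < suc (m ⊓ n)
    far {v} v∈N d< = e∩N (v , x∈p∩q⁺ (v∈e , v∈N))
      where
      v∈e = from (isBall v) (dist c v , dist⇒Dist (<-≤-trans d< (s≤s (m⊓n≤n m n)))
                            , ℤ.+≤+ (≤-trans (s≤s⁻¹ d<) (m⊓n≤m m n)))

  ClosedUpTo : List (Fin n) → Pred (Fin n) 0ℓ → Set
  ClosedUpTo S Z = ∀ {v u} → Z v → v ∉ˡ S → Adj v u → Z u ⊎ u ∈ˡ S

  -- Until it meets `S`, a walk from `Z` stays in `Z`; if it got to its end `v` that way, `v` would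
  -- lie in `Z` and hence in `S`.
  walk-meets : ∀ {S Z} → ClosedUpTo S Z → ∀ {u v} → Z u ⊎ u ∈ˡ S → (Z v → v ∈ˡ S) →
    (p : Walk G u v) →
    ∃[ w ] w ∈ˡ S × Σ (Walk G u w) λ q → Σ (Walk G w v) λ r → length q + length r ≡ length p
  walk-meets closed (inj₂ u∈S) _  p = _ , u∈S , [] , p , refl
  walk-meets {S} closed {u} (inj₁ u∈Z) v∉ p with u ∈ˡ? S
  ... | yes u∈S = u , u∈S , [] , p , refl
  walk-meets closed (inj₁ u∈Z) v∉ []      | no u∉S = contradiction (v∉ u∈Z) u∉S
  walk-meets closed (inj₁ u∈Z) v∉ (e ∷ p) | no u∉S with walk-meets closed (closed u∈Z u∉S e) v∉ p
  ... | w , w∈S , q , r , eq = w , w∈S , e ∷ q , r , cong suc eq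

  -- The bound `k ≤ suc n` turns `dist u v < k` into an actual walk, which is then cut at `S`.
  dist-meets : ∀ {S Z} → ClosedUpTo S Z → ∀ {u v k} → Z u → (Z v → v ∈ˡ S) →
    k ≤ suc n → dist u v < k → ∃[ w ] w ∈ˡ S × dist u w + dist w v < k
  dist-meets closed u∈Z v∉ k≤ d<k with dist⇒within (<-≤-trans d<k k≤)
  ... | p , p≤d with walk-meets closed (inj₁ u∈Z) v∉ p
  ...   | w , w∈S , q , r , eq = w , w∈S
    , ≤-<-trans (≤-trans (+-mono-≤ (walk⇒dist≤ q) (walk⇒dist≤ r)) (≤-trans (≤-reflexive eq) p≤d)) d<k

-- Recursive separations

-- A binary recursive separation: node K W l r says that deleting W splits K
-- into the supports of l and r.
data Tree (n : ℕ) : Set where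
  leaf : Tree n
  node : Subset n → List (Fin n) → Tree n → Tree n → Tree n

module _ {n : ℕ} where

  support : Tree n → Subset n
  support leaf           = ⊥
  support (node K _ _ _) = K

  separator : Tree n → List (Fin n)
  separator leaf           = []
  separator (node _ W _ _) = W

  left right : Tree n → Tree n
  left leaf            = leaf
  left (node _ _ l _)  = l
  right leaf           = leaf
  right (node _ _ _ r) = r

  size : Tree n → ℕ
  size leaf           = zero
  size (node _ _ l r) = suc (size l + size r)

  lca : Tree n → Fin n → Fin n → Tree n
  lca leaf             u v = leaf
  lca d@(node _ _ l r) u v with (u ∈? support l) ×-dec (v ∈? support l) | (u ∈? support r) ×-dec (v ∈? support r)
  ... | yes _ | _     = lca l u v
  ... | no  _ | yes _ = lca r u v
  ... | no  _ | no  _ = d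

  -- The subtree relation, recorded through the consequences that are used. By `lca-local`, an lca
  -- taken inside a subtree can equally be evaluated from the root, which is how the decoder finds
  -- it from two vertices.
  record _≼_ (d′ d : Tree n) : Set where
    field
      support⊆ : support d′ ⊆ support d
      lca-local : ∀ {u v} → u ∈ support d′ → v ∈ support d′ → lca d u v ≡ lca d′ u v
      size≤ : size d′ ≤ size d

  open _≼_ public

  ≼-refl : ∀ {d} → d ≼ d
  ≼-refl = record { support⊆ = id ; lca-local = λ _ _ → refl ; size≤ = ≤-refl }

  ≼-trans : ∀ {d₁ d₂ d₃} → d₁ ≼ d₂ → d₂ ≼ d₃ → d₁ ≼ d₃
  ≼-trans p q = record
    { support⊆  = support⊆ q ∘ support⊆ p
    ; lca-local = λ u∈ v∈ → trans (lca-local q (support⊆ p u∈) (support⊆ p v∈)) (lca-local p u∈ v∈)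
    ; size≤     = ≤-trans (size≤ p) (size≤ q)
    }

  Split : List (Fin n) → Tree n → Set
  Split X b = ∀ {v} → v ∈ˡ X → v ∈ˡ separator b ⊎ (v ∈ support (left b) ⊎ v ∈ support (right b))

  left-smaller : ∀ b {v} → v ∈ support (left b) → size (left b) < size b
  left-smaller leaf           v∈ = contradiction v∈ ∉⊥
  left-smaller (node _ _ _ _) _  = s≤s (m≤m+n _ _)

  right-smaller : ∀ b {v} → v ∈ support (right b) → size (right b) < size b
  right-smaller leaf           v∈ = contradiction v∈ ∉⊥
  right-smaller (node _ _ _ _) _  = s≤s (m≤n+m _ _)

module _ {n : ℕ} (G : Graph n) where
  open Graph G

  Closed : List (Fin n) → Tree n → Set
  Closed W d = ∀ {u v} → u ∈ support d → Adj u v → v ∈ support d ⊎ v ∈ˡ W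

module _ {n : ℕ} (G : Graph n) (s : ℕ) where
  open Graph G

  data Valid : Tree n → Set
  record ValidNode (K : Subset n) (W : List (Fin n)) (l r : Tree n) : Set

  data Valid where
    leaf : Valid leaf
    node : ∀ {K W l r} → ValidNode K W l r → Valid (node K W l r)

  record ValidNode K W l r where
    inductive
    field
      cover    : ∀ {v} → v ∈ K → v ∈ˡ W ⊎ (v ∈ support l ⊎ v ∈ support r)
      left⊆    : support l ⊆ K
      right⊆   : support r ⊆ K
      disjoint : ∀ {v} → v ∈ support l → v ∉ support r
      left∉    : ∀ {v} → v ∈ support l → v ∉ˡ W
      right∉   : ∀ {v} → v ∈ support r → v ∉ˡ W
      closedˡ  : ∀ {u v} → u ∈ support l → Adj u v → v ∈ support l ⊎ v ∈ˡ W
      closedʳ  : ∀ {u v} → u ∈ support r → Adj u v → v ∈ support r ⊎ v ∈ˡ W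
      small    : List.length W ≤ s
      validˡ   : Valid l
      validʳ   : Valid r

module _ {n : ℕ} {G : Graph n} {s : ℕ} where
  open Graph G
  open ValidNode

  lca-left : ∀ {K W l r u v} → ValidNode G s K W l r →
             u ∈ support l → v ∈ support l → lca (node K W l r) u v ≡ lca l u v
  lca-left {l = l} {r} {u} {v} _ u∈ v∈ with (u ∈? support l) ×-dec (v ∈? support l) | (u ∈? support r) ×-dec (v ∈? support r)
  ... | yes _ | _ = refl
  ... | no ¬∈ | _ = contradiction (u∈ , v∈) ¬∈

  lca-right : ∀ {K W l r u v} → ValidNode G s K W l r →
              u ∈ support r → v ∈ support r → lca (node K W l r) u v ≡ lca r u v
  lca-right {l = l} {r} {u} {v} val u∈ v∈ with (u ∈? support l) ×-dec (v ∈? support l) | (u ∈? support r) ×-dec (v ∈? support r)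
  ... | yes (u∈l , _) | _ = contradiction u∈ (disjoint val u∈l)
  ... | no _ | yes _ = refl
  ... | no _ | no ¬∈ = contradiction (u∈ , v∈) ¬∈

  lca-top : ∀ {K W l r u v} → ValidNode G s K W l r → ¬ (u ∈ support l × v ∈ support l) → ¬ (u ∈ support r × v ∈ support r) →
            lca (node K W l r) u v ≡ node K W l r
  lca-top {l = l} {r} {u} {v} _ ¬l ¬r with (u ∈? support l) ×-dec (v ∈? support l) | (u ∈? support r) ×-dec (v ∈? support r)
  ... | yes ∈l | _ = contradiction ∈l ¬l
  ... | no _ | yes ∈r = contradiction ∈r ¬r
  ... | no _ | no _ = refl

  valid-left : ∀ {d} → Valid G s d → Valid G s (left d)
  valid-left leaf       = leaf
  valid-left (node val) = validˡ val

  valid-right : ∀ {d} → Valid G s d → Valid G s (right d)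
  valid-right leaf       = leaf
  valid-right (node val) = validʳ val

  valid-small : ∀ {d} → Valid G s d → List.length (separator d) ≤ s
  valid-small leaf       = z≤n
  valid-small (node val) = small val

  closed-left : ∀ {d} → Valid G s d → Closed G (separator d) (left d)
  closed-left leaf       u∈ = contradiction u∈ ∉⊥
  closed-left (node val) u∈ = closedˡ val u∈

  closed-right : ∀ {d} → Valid G s d → Closed G (separator d) (right d)
  closed-right leaf       u∈ = contradiction u∈ ∉⊥
  closed-right (node val) u∈ = closedʳ val u∈

  left≼ : ∀ {d} → Valid G s d → left d ≼ d
  left≼ leaf = ≼-refl
  left≼ (node val) = record
    { support⊆  = left⊆ val
    ; lca-local = lca-left val
    ; size≤     = m≤n⇒m≤1+n (m≤m+n _ _)
    }

  right≼ : ∀ {d} → Valid G s d → right d ≼ d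
  right≼ leaf = ≼-refl
  right≼ (node val) = record
    { support⊆  = right⊆ val
    ; lca-local = lca-right val
    ; size≤     = m≤n⇒m≤1+n (m≤n+m _ _)
    }

  lca≼ : ∀ {d} → Valid G s d → ∀ u v → lca d u v ≼ d × Valid G s (lca d u v)
  lca≼ leaf u v = ≼-refl , leaf
  lca≼ (node {K} {W} {l} {r} val) u v with (u ∈? support l) ×-dec (v ∈? support l) | (u ∈? support r) ×-dec (v ∈? support r)
  ... | yes _ | _     = let p , q = lca≼ (validˡ val) u v in ≼-trans p (left≼ (node val)) , q
  ... | no  _ | yes _ = let p , q = lca≼ (validʳ val) u v in ≼-trans p (right≼ (node val)) , q
  ... | no  _ | no  _ = ≼-refl , node val

  -- The lca of all points is already the lca of two of them. If a point lies in `W`, it can be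
  -- taken twice, since the children avoid `W`. If all points lie in one child, recurse there.
  -- Otherwise one point outside the left child and one outside the right child have the current
  -- node as their lca.
  split-lca : ∀ {d} → Valid G s d → ∀ x X → All (_∈ support d) (x ∷ X) →
    ∃[ u ] ∃[ v ] u ∈ˡ (x ∷ X) × v ∈ˡ (x ∷ X) × Split (x ∷ X) (lca d u v)
  split-lca leaf x X (x∈ ∷ _) = contradiction x∈ ∉⊥
  split-lca d@{node K W l r} (node val) x X X⊆ with Any.any? (_∈ˡ? W) (x ∷ X)
  ... | yes any with find any
  ...   | v , v∈ , v∈W = v , v , v∈ , v∈ , subst (Split (x ∷ X)) (sym (lca-top val
            (λ (v∈l , _) → left∉ val v∈l v∈W) (λ (v∈r , _) → right∉ val v∈r v∈W)))
            (λ y∈ → cover val (All.lookup X⊆ y∈))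
  split-lca d@{node K W l r} (node val) x X X⊆ | no none with All.all? (_∈? support l) (x ∷ X)
  ... | yes all = let u , v , u∈ , v∈ , spl = split-lca (validˡ val) x X all in
    u , v , u∈ , v∈ , subst (Split (x ∷ X)) (sym (lca-left val (All.lookup all u∈) (All.lookup all v∈))) spl
  ... | no ¬allˡ with All.all? (_∈? support r) (x ∷ X)
  ...   | yes all = let u , v , u∈ , v∈ , spl = split-lca (validʳ val) x X all in
    u , v , u∈ , v∈ , subst (Split (x ∷ X)) (sym (lca-right val (All.lookup all u∈) (All.lookup all v∈))) spl
  ...   | no ¬allʳ with find (¬All⇒Any¬ (_∈? support l) _ ¬allˡ) | find (¬All⇒Any¬ (_∈? support r) _ ¬allʳ)
  ...     | u , u∈ , u∉ | v , v∈ , v∉ = u , v , u∈ , v∈ , subst (Split (x ∷ X)) (sym (lca-top val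
            (λ (u∈l , _) → u∉ u∈l) (λ (_ , v∈r) → v∉ v∈r)))
            (λ y∈ → cover val (All.lookup X⊆ y∈))

-- Naming the region of the centre by sample points

Pointer : ℕ → Set
Pointer n = Maybe (Fin n)

module _ {n : ℕ} where

  -- The subtree hanging below an lca, together with the separator above it;
  -- the third pointer only tells left from right.
  below : Tree n → Pointer n → Pointer n → Pointer n → Tree n × List (Fin n)
  below root (just u) (just v) nothing  = left  (lca root u v) , separator (lca root u v)
  below root (just u) (just v) (just _) = right (lca root u v) , separator (lca root u v)
  below root _        _        _        = root , []

  -- Null pointers encode a region without sample points: the empty `leaf` cuts nothing away from
  -- `d` and adds nothing to its boundary.
  core : Tree n → Pointer n → Pointer n → Tree n
  core d (just u) (just v) = lca d u v
  core d _        _        = leaf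

  Between : Tree n → Tree n → Pred (Fin n) 0ℓ
  Between d b v = v ∈ support d × (v ∉ support (left b) × v ∉ support (right b))

  between? : ∀ d b → Decidable (Between d b)
  between? d b v = (v ∈? support d) ×-dec (¬? (v ∈? support (left b)) ×-dec ¬? (v ∈? support (right b)))

  Points : List (Fin n) → Pointer n → Set
  Points X = Maybe.All (_∈ˡ X)

module _ {n : ℕ} (G : Graph n) (s : ℕ) (root : Tree n) (X : List (Fin n)) (c : Fin n) where
  open Graph G

  -- The trees `d`, `b` and the list `S`, including its order, are functions of `root` and five
  -- pointers, so a decoder that knows the pointers rebuilds them exactly.
  record Located : Set where
    field
      u₁ u₂ side v₁ v₂ : Pointer n
    d = proj₁ (below root u₁ u₂ side)
    b = core d v₁ v₂
    S = proj₂ (below root u₁ u₂ side) ++ separator b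
    field
      pointers : All (Points X) (u₁ ∷ u₂ ∷ side ∷ v₁ ∷ v₂ ∷ [])
      small    : List.length S ≤ s + s
      closed   : ClosedUpTo G S (Between d b)
      centre   : Between d b c
      caught   : ∀ {v} → v ∈ˡ X → Between d b v → v ∈ˡ S

  -- Descends towards `c`: at each stage `b` is the lca of the sample points in `d`, and the search
  -- continues in the child of `b` containing `c`, or stops if neither does. Only the latest lca has
  -- to be remembered, as its separator closes off the child. Since that child is computed and not a
  -- syntactic subterm, `fuel` bounds its size.
  locate-from : ∀ fuel {d W} → size d ≤ fuel → Valid G s d → d ≼ root →
    Closed G W d → List.length W ≤ s → c ∈ support d →
    ∀ u₁ u₂ side → All (Points X) (u₁ ∷ u₂ ∷ side ∷ []) → below root u₁ u₂ side ≡ (d , W) → Located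
  locate-from zero {leaf} _ _ _ _ _ c∈ = contradiction c∈ ∉⊥
  locate-from (suc fuel) {d} {W} size≤fuel val d≼ clo W≤ c∈ u₁ u₂ side (p₁ ∷ p₂ ∷ p₃ ∷ []) refl
    with filter (_∈? support d) X in eq
  -- No sample point lies in `d`, so the region is all of `d` and `W` alone bounds it.
  ... | [] = record
    { v₁ = nothing ; v₂ = nothing
    ; pointers = p₁ ∷ p₂ ∷ p₃ ∷ nothing ∷ nothing ∷ []
    ; small    = ≤-trans (≤-reflexive (cong List.length (++-identityʳ W))) (≤-trans W≤ (m≤m+n s s))
    ; closed   = λ { (v∈ , _) _ adj → case clo v∈ adj of λ
        { (inj₁ u∈) → inj₁ (u∈ , ∉⊥ , ∉⊥) ; (inj₂ u∈) → inj₂ (∈-++⁺ˡ u∈) } }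
    ; centre   = c∈ , ∉⊥ , ∉⊥
    ; caught   = λ { v∈X (v∈d , _) → case subst (_ ∈ˡ_) eq (∈-filter⁺ (_∈? support d) v∈X v∈d) of λ () }
    }
  ... | x ∷ X′ with split-lca val x X′ (All.tabulate (λ v∈ → proj₂ (∈-filter⁻ (_∈? support d) {xs = X} (subst (_ ∈ˡ_) (sym eq) v∈))))
  ...   | u , v , u∈ , v∈ , split = descend
    where
    b  = lca d u v
    b≼d = proj₁ (lca≼ val u v)
    valᵇ = proj₂ (lca≼ val u v)

    selected : ∀ {v} → v ∈ˡ (x ∷ X′) → v ∈ˡ X × v ∈ support d
    selected v∈ = ∈-filter⁻ (_∈? support d) (subst (_ ∈ˡ_) (sym eq) v∈)

    u∈X = proj₁ (selected u∈)
    v∈X = proj₁ (selected v∈)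

    lca≡b : lca root u v ≡ b
    lca≡b = lca-local d≼ (proj₂ (selected u∈)) (proj₂ (selected v∈))

    descend : Located
    descend with c ∈? support (left b) | c ∈? support (right b)
    ... | yes c∈l | _ =
      locate-from fuel (s≤s⁻¹ (≤-trans (left-smaller b c∈l) (≤-trans (size≤ b≼d) size≤fuel)))
        (valid-left valᵇ) (≼-trans (left≼ valᵇ) (≼-trans b≼d d≼))
        (closed-left valᵇ) (valid-small valᵇ) c∈l
        (just u) (just v) nothing (just u∈X ∷ just v∈X ∷ nothing ∷ [])
        (cong (λ b → left b , separator b) lca≡b)
    ... | no _ | yes c∈r =
      locate-from fuel (s≤s⁻¹ (≤-trans (right-smaller b c∈r) (≤-trans (size≤ b≼d) size≤fuel)))
        (valid-right valᵇ) (≼-trans (right≼ valᵇ) (≼-trans b≼d d≼))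
        (closed-right valᵇ) (valid-small valᵇ) c∈r
        (just u) (just v) (just u) (just u∈X ∷ just v∈X ∷ just u∈X ∷ [])
        (cong (λ b → right b , separator b) lca≡b)
    ... | no c∉l | no c∉r = record
      { v₁ = just u ; v₂ = just v
      ; pointers = p₁ ∷ p₂ ∷ p₃ ∷ just u∈X ∷ just v∈X ∷ []
      ; small    = ≤-trans (≤-reflexive (length-++ W)) (+-mono-≤ W≤ (valid-small valᵇ))
      ; closed   = closed
      ; centre   = c∈ , c∉l , c∉r
      ; caught   = λ { v∈X (v∈d , v∉l , v∉r) →
          case split (subst (_ ∈ˡ_) eq (∈-filter⁺ (_∈? support d) v∈X v∈d)) of λ
            { (inj₁ v∈) → ∈-++⁺ʳ W v∈
            ; (inj₂ (inj₁ v∈l)) → contradiction v∈l v∉l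
            ; (inj₂ (inj₂ v∈r)) → contradiction v∈r v∉r } }
      }
      where
      closed : ClosedUpTo G (W ++ separator b) (Between d b)
      closed {y} {z} (y∈d , y∉l , y∉r) y∉S adj
        with clo y∈d adj | z ∈? support (left b) | z ∈? support (right b)
      ... | inj₂ z∈W | _ | _ = inj₂ (∈-++⁺ˡ z∈W)
      ... | inj₁ z∈d | no z∉l | no z∉r = inj₁ (z∈d , z∉l , z∉r)
      -- Read backwards, an edge entering a child of `b` leaves that child, so its outer end lies in
      -- the separator of `b` and hence in `S`.
      ... | inj₁ z∈d | yes z∈l | _ = case closed-left valᵇ z∈l (symm adj) of λ
        { (inj₁ y∈l) → contradiction y∈l y∉l ; (inj₂ y∈W) → contradiction (∈-++⁺ʳ W y∈W) y∉S }
      ... | inj₁ z∈d | no _ | yes z∈r = case closed-right valᵇ z∈r (symm adj) of λ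
        { (inj₁ y∈r) → contradiction y∈r y∉r ; (inj₂ y∈W) → contradiction (∈-++⁺ʳ W y∈W) y∉S }

  locate : Valid G s root → (∀ v → v ∈ support root) → Located
  locate val full = locate-from (size root) ≤-refl val ≼-refl (λ _ _ → inj₁ (full _)) z≤n (full c)
    nothing nothing nothing (nothing ∷ nothing ∷ nothing ∷ []) refl

-- From tree decompositions to recursive separations

delete : ∀ {m} → Graph m → Fin m → Graph m
delete T x = record
  { Adj    = λ u v → Adj u v × (u ≢ x × v ≢ x)
  ; adj?   = λ u v → adj? u v ×-dec (¬? (u ≟ x) ×-dec ¬? (v ≟ x))
  ; symm   = λ (e , u≢ , v≢) → symm e , v≢ , u≢
  ; irrefl = λ u≡v (e , _) → irrefl u≡v e
  }
  where open Graph T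

module _ {m : ℕ} {T : Graph m} {x : Fin m} where

  undelete : ∀ {u v} → Walk (delete T x) u v → Walk T u v
  undelete []            = []
  undelete ((e , _) ∷ p) = e ∷ undelete p

  vertices-undelete : ∀ {u v} (p : Walk (delete T x) u v) → vertices (undelete p) ≡ vertices p
  vertices-undelete []      = refl
  vertices-undelete (_ ∷ p) = cong (_ ∷_) (vertices-undelete p)

  avoids : ∀ {u v} → u ≢ x → (p : Walk (delete T x) u v) → All (x ≢_) (vertices p)
  avoids u≢x []                   = u≢x ∘ sym ∷ []
  avoids u≢x ((_ , _ , w≢x) ∷ p) = u≢x ∘ sym ∷ avoids w≢x p

  -- Two distinct neighbours of `x` joined by a walk that avoids `x` close up to a cycle through
  -- `x`; distinctness makes the path long enough.
  deleted-walk⇒cycle : ∀ {y v} → Graph.Adj T x v → Graph.Adj T y x → v ≢ y → v ≢ x →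
                       Walk (delete T x) v y → Cycle T
  deleted-walk⇒cycle {y} xv yx v≢y v≢x p with walk⇒path p
  ... | []         , _  , _ = contradiction refl v≢y
  ... | q@(_ ∷ _) , q! , _ = y , x , yx
    , (xv ∷ undelete q , subst Unique (cong (x ∷_) (sym (vertices-undelete q))) (avoids v≢x q ∷ q!))
    , s≤s (s≤s z≤n)

module _ {n : ℕ} {G : Graph n} (𝒟 : TreeDecomposition G) {s : ℕ} (bag≤s : ∀ x → ∣ TreeDecomposition.bag 𝒟 x ∣ ≤ s) where
  open Graph G
  open TreeDecomposition 𝒟
  open Graph T using () renaming (Adj to _~_; symm to ~-sym; irrefl to ~-irrefl)
  open IsTree isTree

  -- A union of connected components of the tree with `x` removed.
  record Branch (x : Fin m) (B : Subset m) : Set where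
    field
      apex∉ : x ∉ B
      step  : ∀ {y z} → y ∈ B → y ~ z → z ∈ B ⊎ z ≡ x

  open Branch

  Shadow : Fin m → Subset m → Pred (Fin n) 0ℓ
  Shadow x B v = (∃[ y ] y ∈ B × v ∈ bag y) × v ∉ bag x

  shadow? : ∀ x B → Decidable (Shadow x B)
  shadow? x B v = any? (λ y → (y ∈? B) ×-dec (v ∈? bag y)) ×-dec ¬? (v ∈? bag x)

  shadow : Fin m → Subset m → Subset n
  shadow x B = comprehension (shadow? x B)

  stay : ∀ {x B y z} → Branch x B → y ∈ B → (p : Walk T y z) → x ∉ˡ vertices p → z ∈ B
  stay br y∈ []      x∉ = y∈
  stay br y∈ (e ∷ p) x∉ with step br y∈ e
  ... | inj₁ z∈   = stay br z∈ p (x∉ ∘ there)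
  ... | inj₂ refl = contradiction (there (start∈ p)) x∉
    where
    start∈ : ∀ {u v} (p : Walk T u v) → u ∈ˡ vertices p
    start∈ []      = here refl
    start∈ (_ ∷ _) = here refl

  -- The nodes whose bags contain `v` are linked by walks through such nodes. These walks avoid `x`,
  -- as `v` is not in its bag, and so cannot leave `B`.
  shadow-local : ∀ {x B v z} → Branch x B → Shadow x B v → v ∈ bag z → z ∈ B
  shadow-local br ((y , y∈ , v∈y) , v∉x) v∈z with coherent v∈y v∈z
  ... | p , v∈p = stay br y∈ p (λ x∈p → v∉x (All.lookup v∈p x∈p))

  -- Some bag holds both ends of the edge, and by `shadow-local` its node lies in `B`.
  shadow-closed : ∀ {x B u v} → Branch x B → Shadow x B u → Adj u v → Shadow x B v ⊎ v ∈ bag x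
  shadow-closed {x} {v = v} br sh uv with v ∈? bag x
  ... | yes v∈x = inj₂ v∈x
  ... | no  v∉x with coverEdge uv
  ...   | z , u∈z , v∈z = inj₁ ((z , shadow-local br sh u∈z , v∈z) , v∉x)

  neighbour : ∀ {x B y} → Branch x B → y ∈ B → Walk T y x → ∃[ z ] z ∈ B × z ~ x
  neighbour br y∈ []      = contradiction y∈ (apex∉ br)
  neighbour br y∈ (e ∷ p) with step br y∈ e
  ... | inj₁ z∈   = neighbour br z∈ p
  ... | inj₂ refl = _ , y∈ , e

  record Built (x : Fin m) (B : Subset m) : Set where
    field
      tree     : Tree n
      valid    : Valid G s tree
      sound    : ∀ {v} → v ∈ support tree → Shadow x B v
      complete : ∀ {v} → Shadow x B v → v ∈ support tree

  bag-list : Fin m → List (Fin n)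
  bag-list x = elements (bag x)

  bag-list≤ : ∀ x → List.length (bag-list x) ≤ s
  bag-list≤ x = ≤-trans (≤-reflexive (length-elements (bag x))) (bag≤s x)

  -- D is the part of B behind the neighbour y of x.  The bag of x is repeated in
  -- the right subtree, which makes the tree binary.
  build : ∀ {x B} → Acc _⊂_ B → Branch x B → Built x B
  build {x} {B} (acc rec) br with nonempty? B
  ... | no  empty = record
    { tree = leaf ; valid = leaf
    ; sound = λ v∈ → contradiction v∈ ∉⊥
    ; complete = λ { ((y , y∈ , _) , _) → contradiction (y , y∈) empty } }
  ... | yes (y₀ , y₀∈) with neighbour br y₀∈ (connected y₀ x)
  ...   | y , y∈ , y~x = record
    { tree     = node (shadow x B) (bag-list x) l R.tree
    ; valid    = node (record
      { cover    = cover
      ; left⊆    = λ v∈ → let (z , z∈ , v∈z) , v∉x = fromˡ v∈ in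
                     ∈-comprehension⁺ (shadow? x B) ((z , D⊆B z∈ , v∈z) , v∉x)
      ; right⊆   = λ v∈ → let (z , z∈ , v∈z) , v∉x = R.sound v∈ in
                     ∈-comprehension⁺ (shadow? x B) ((z , E⊆B z∈ , v∈z) , v∉x)
      ; disjoint = λ v∈l v∈r → let (z , z∈ , v∈z) , _ = R.sound v∈r in
                     -- A vertex in both shadows has a bag at a node of `E`, but `shadow-local` for
                     -- `D` puts that node in `D`.
                     proj₂ (fromE z∈) (shadow-local brD (fromˡ v∈l) v∈z)
      ; left∉    = λ v∈ v∈x → proj₂ (fromˡ v∈) (∈-elements⁻ (bag x) v∈x)
      ; right∉   = λ v∈ v∈x → proj₂ (R.sound v∈) (∈-elements⁻ (bag x) v∈x)
      ; closedˡ  = λ u∈ uv → case shadow-closed brD (fromˡ u∈) uv of λ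
          { (inj₁ sh) → inj₁ (∈-comprehension⁺ (shadow? x D) sh) ; (inj₂ v∈x) → inj₂ (∈-elements⁺ v∈x) }
      ; closedʳ  = λ u∈ uv → case shadow-closed brE (R.sound u∈) uv of λ
          { (inj₁ sh) → inj₁ (R.complete sh) ; (inj₂ v∈x) → inj₂ (∈-elements⁺ v∈x) }
      ; small    = bag-list≤ x
      ; validˡ   = node (record
        { cover    = coverˡ
        ; left⊆    = λ v∈ → let (z , z∈ , v∈z) , v∉y = L.sound v∈ in
            -- Such a vertex is absent from the bag of `x`, since otherwise `shadow-local` would
            -- place `x` itself in `D′`.
            ∈-comprehension⁺ (shadow? x D) ((z , proj₁ (fromD′ z∈) , v∈z)
              , λ v∈x → x∉D (proj₁ (fromD′ (shadow-local brD′ (L.sound v∈) v∈x))))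
        ; right⊆   = λ v∈ → contradiction v∈ ∉⊥
        ; disjoint = λ _ → ∉⊥
        ; left∉    = λ v∈ v∈y → proj₂ (L.sound v∈) (∈-elements⁻ (bag y) v∈y)
        ; right∉   = λ v∈ → contradiction v∈ ∉⊥
        ; closedˡ  = λ u∈ uv → case shadow-closed brD′ (L.sound u∈) uv of λ
            { (inj₁ sh) → inj₁ (L.complete sh) ; (inj₂ v∈y) → inj₂ (∈-elements⁺ v∈y) }
        ; closedʳ  = λ u∈ → contradiction u∈ ∉⊥
        ; small    = bag-list≤ y
        ; validˡ   = L.valid
        ; validʳ   = leaf
        })
      ; validʳ   = R.valid
      })
    ; sound    = ∈-comprehension⁻ (shadow? x B)
    ; complete = ∈-comprehension⁺ (shadow? x B)
    }
    where
    D? : Decidable (λ v → v ∈ B × Walk (delete T x) v y)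
    D? v = (v ∈? B) ×-dec walk? (delete T x) v y
    D = comprehension D?

    fromD : ∀ {v} → v ∈ D → v ∈ B × Walk (delete T x) v y
    fromD = ∈-comprehension⁻ D?

    D′? : Decidable (λ v → v ∈ D × v ≢ y)
    D′? v = (v ∈? D) ×-dec ¬? (v ≟ y)
    D′ = comprehension D′?

    fromD′ : ∀ {v} → v ∈ D′ → v ∈ D × v ≢ y
    fromD′ = ∈-comprehension⁻ D′?

    E? : Decidable (λ v → v ∈ B × v ∉ D)
    E? v = (v ∈? B) ×-dec ¬? (v ∈? D)
    E = comprehension E?

    fromE : ∀ {v} → v ∈ E → v ∈ B × v ∉ D
    fromE = ∈-comprehension⁻ E?

    D⊆B : D ⊆ B
    D⊆B = proj₁ ∘ fromD

    E⊆B : E ⊆ B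
    E⊆B = proj₁ ∘ fromE

    ≢x : ∀ {v} → v ∈ B → v ≢ x
    ≢x v∈ refl = apex∉ br v∈

    x∉D : x ∉ D
    x∉D = apex∉ br ∘ D⊆B

    y∈D : y ∈ D
    y∈D = ∈-comprehension⁺ D? (y∈ , [])

    brD : Branch x D
    brD = record { apex∉ = x∉D ; step = stepD }
      where
      stepD : ∀ {v z} → v ∈ D → v ~ z → z ∈ D ⊎ z ≡ x
      stepD v∈ vz with step br (D⊆B v∈) vz
      ... | inj₂ z≡x = inj₂ z≡x
      ... | inj₁ z∈  = inj₁ (∈-comprehension⁺ D?
        (z∈ , (~-sym vz , ≢x z∈ , ≢x (D⊆B v∈)) ∷ proj₂ (fromD v∈)))

    brE : Branch x E
    brE = record { apex∉ = apex∉ br ∘ E⊆B ; step = stepE }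
      where
      stepE : ∀ {v z} → v ∈ E → v ~ z → z ∈ E ⊎ z ≡ x
      stepE {v} {z} v∈ vz with step br (E⊆B v∈) vz | z ∈? D
      ... | inj₂ z≡x | _      = inj₂ z≡x
      ... | inj₁ z∈  | no z∉D = inj₁ (∈-comprehension⁺ E? (z∈ , z∉D))
      ... | inj₁ z∈  | yes z∈D with step brD z∈D (~-sym vz)
      ...   | inj₁ v∈D = contradiction v∈D (proj₂ (fromE v∈))
      ...   | inj₂ v≡x = contradiction v≡x (≢x (E⊆B v∈))

    brD′ : Branch y D′
    brD′ = record { apex∉ = λ y∈ → proj₂ (fromD′ y∈) refl ; step = stepD′ }
      where
      stepD′ : ∀ {v z} → v ∈ D′ → v ~ z → z ∈ D′ ⊎ z ≡ y
      stepD′ {v} {z} v∈ vz with fromD′ v∈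
      ... | v∈D , v≢y with step brD v∈D vz | z ≟ y
      ...   | _         | yes z≡y = inj₂ z≡y
      ...   | inj₁ z∈D  | no  z≢y = inj₁ (∈-comprehension⁺ D′? (z∈D , z≢y))
      -- Here `v` would be a second neighbour of `x` in the component of `y`, against acyclicity;
      -- hence removing `y` cuts the rest of `D` off from `x`.
      ...   | inj₂ refl | no  _   = contradiction
        (deleted-walk⇒cycle (~-sym vz) y~x v≢y (≢x (D⊆B v∈D)) (proj₂ (fromD v∈D))) acyclic

    -- Both recursive calls are on proper subsets of `B`, because each omits `y`.
    module L = Built (build (rec (D⊆B ∘ proj₁ ∘ fromD′ , y , y∈ , λ y∈D′ → proj₂ (fromD′ y∈D′) refl)) brD′)
    module R = Built (build (rec (E⊆B , y , y∈ , λ y∈E → proj₂ (fromE y∈E) y∈D)) brE)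

    l : Tree n
    l = node (shadow x D) (bag-list y) L.tree leaf

    fromˡ : ∀ {v} → v ∈ shadow x D → Shadow x D v
    fromˡ = ∈-comprehension⁻ (shadow? x D)

    cover : ∀ {v} → v ∈ shadow x B → v ∈ˡ bag-list x ⊎ (v ∈ shadow x D ⊎ v ∈ support R.tree)
    cover v∈ with ∈-comprehension⁻ (shadow? x B) v∈
    ... | (z , z∈ , v∈z) , v∉x with z ∈? D
    ...   | yes z∈D = inj₂ (inj₁ (∈-comprehension⁺ (shadow? x D) ((z , z∈D , v∈z) , v∉x)))
    ...   | no  z∉D = inj₂ (inj₂ (R.complete ((z , ∈-comprehension⁺ E? (z∈ , z∉D) , v∈z) , v∉x)))

    coverˡ : ∀ {v} → v ∈ shadow x D → v ∈ˡ bag-list y ⊎ (v ∈ support L.tree ⊎ v ∈ ⊥)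
    coverˡ {v} v∈ with fromˡ v∈ | v ∈? bag y
    ... | _ | yes v∈y = inj₁ (∈-elements⁺ v∈y)
    ... | (z , z∈ , v∈z) , v∉x | no v∉y =
      inj₂ (inj₁ (L.complete ((z , ∈-comprehension⁺ D′? (z∈ , λ { refl → v∉y v∈z }) , v∈z) , v∉y)))

  separation-tree : Σ (Tree n) λ d → Valid G s d × (∀ v → v ∈ support d)
  separation-tree = d , valid-d , λ v → ∈⊤
    where
    x : Fin m
    -- The decomposition tree is rooted at its first node, which exists because a tree is nonempty.
    x = fromℕ< {0} (>-nonZero⁻¹ m {{nonEmpty}})

    br : Branch x (∁ ⁅ x ⁆)
    br = record
      { apex∉ = λ x∈ → x∈∁p⇒x∉p x∈ (x∈⁅x⁆ x)
      ; step  = λ {_} {z} _ _ → case z ≟ x of λ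
          { (yes z≡x) → inj₂ z≡x
          ; (no z≢x)  → inj₁ (x∉p⇒x∈∁p (λ z∈ → z≢x (x∈⁅y⁆⇒x≡y x z∈))) }
      }

    open Built (build (⊂-wellFounded _) br)

    d : Tree n
    d = node ⊤ (bag-list x) tree leaf

    cover : ∀ {v} → v ∈ ⊤ → v ∈ˡ bag-list x ⊎ (v ∈ support tree ⊎ v ∈ ⊥)
    cover {v} _ with v ∈? bag x | coverVertex v
    ... | yes v∈x | _ = inj₁ (∈-elements⁺ v∈x)
    ... | no  v∉x | y , v∈y = inj₂ (inj₁ (complete ((y
      , x∉p⇒x∈∁p (λ y∈ → v∉x (subst (λ y → v ∈ bag y) (x∈⁅y⁆⇒x≡y x y∈) v∈y)) , v∈y) , v∉x)))

    valid-d : Valid G s d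
    valid-d = node (record
      { cover    = cover
      ; left⊆    = λ _ → ∈⊤
      ; right⊆   = λ _ → ∈⊤
      ; disjoint = λ _ → ∉⊥
      ; left∉    = λ v∈ v∈x → proj₂ (sound v∈) (∈-elements⁻ (bag x) v∈x)
      ; right∉   = λ v∈ → contradiction v∈ ∉⊥
      ; closedˡ  = λ u∈ uv → case shadow-closed br (sound u∈) uv of λ
          { (inj₁ sh) → inj₁ (complete sh) ; (inj₂ v∈x) → inj₂ (∈-elements⁺ v∈x) }
      ; closedʳ  = λ u∈ → contradiction u∈ ∉⊥
      ; small    = bag-list≤ x
      ; validˡ   = valid
      ; validʳ   = leaf
      })

-- Bit strings and pointers

∣p∪q∣≤∣p∣+∣q∣ : ∀ {n} (p q : Subset n) → ∣ p ∪ q ∣ ≤ ∣ p ∣ + ∣ q ∣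
∣p∪q∣≤∣p∣+∣q∣ Vec.[]            Vec.[]            = z≤n
∣p∪q∣≤∣p∣+∣q∣ (inside  Vec.∷ p) (inside  Vec.∷ q) = s≤s (≤-trans (∣p∪q∣≤∣p∣+∣q∣ p q) (+-monoʳ-≤ ∣ p ∣ (n≤1+n _)))
∣p∪q∣≤∣p∣+∣q∣ (inside  Vec.∷ p) (outside Vec.∷ q) = s≤s (∣p∪q∣≤∣p∣+∣q∣ p q)
∣p∪q∣≤∣p∣+∣q∣ (outside Vec.∷ p) (inside  Vec.∷ q) = ≤-trans (s≤s (∣p∪q∣≤∣p∣+∣q∣ p q)) (≤-reflexive (sym (+-suc ∣ p ∣ ∣ q ∣)))
∣p∪q∣≤∣p∣+∣q∣ (outside Vec.∷ p) (outside Vec.∷ q) = ∣p∪q∣≤∣p∣+∣q∣ p q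

fromList : ∀ {n} → List (Fin n) → Subset n
fromList xs = ⋃ (List.map ⁅_⁆ xs)

∣fromList∣≤length : ∀ {n} (xs : List (Fin n)) → ∣ fromList xs ∣ ≤ List.length xs
∣fromList∣≤length {n} [] = ≤-reflexive (∣⊥∣≡0 n)
∣fromList∣≤length (x ∷ xs) = ≤-trans (∣p∪q∣≤∣p∣+∣q∣ ⁅ x ⁆ (fromList xs))
  (+-mono-≤ (≤-reflexive (∣⁅x⁆∣≡1 x)) (∣fromList∣≤length xs))

∈-fromList : ∀ {n x} {xs : List (Fin n)} → x ∈ˡ xs → x ∈ fromList xs
∈-fromList (here {x = x} {xs} refl) = p⊆p∪q (fromList xs) (x∈⁅x⁆ x)
∈-fromList (there {x} {xs} x∈) = q⊆p∪q ⁅ x ⁆ (fromList xs) (∈-fromList x∈)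

encodeℕ : ℕ → ℕ → List Bool
encodeℕ zero    x = []
encodeℕ (suc ℓ) x with 2 ^ ℓ ≤? x
... | yes _ = true  ∷ encodeℕ ℓ (x ∸ 2 ^ ℓ)
... | no  _ = false ∷ encodeℕ ℓ x

decodeℕ : ℕ → List Bool → ℕ × List Bool
decodeℕ zero    bs       = 0 , bs
decodeℕ (suc ℓ) []       = 0 , []
decodeℕ (suc ℓ) (b ∷ bs) = let x , rest = decodeℕ ℓ bs in (if b then 2 ^ ℓ + x else x) , rest

length-encodeℕ : ∀ ℓ x → List.length (encodeℕ ℓ x) ≡ ℓ
length-encodeℕ zero    x = refl
length-encodeℕ (suc ℓ) x with 2 ^ ℓ ≤? x
... | yes _ = cong suc (length-encodeℕ ℓ _)
... | no  _ = cong suc (length-encodeℕ ℓ x)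

upper-half : ∀ ℓ {x} → 2 ^ ℓ ≤ x → x < 2 ^ suc ℓ → x ∸ 2 ^ ℓ < 2 ^ ℓ
upper-half ℓ {x} ≤x x< = +-cancelˡ-< (2 ^ ℓ) _ _ (subst (_< 2 ^ ℓ + 2 ^ ℓ) (sym (m+[n∸m]≡n ≤x))
  (subst (λ z → x < 2 ^ ℓ + z) (+-identityʳ (2 ^ ℓ)) x<))

decode-encodeℕ : ∀ ℓ {x} bs → x < 2 ^ ℓ → decodeℕ ℓ (encodeℕ ℓ x ++ bs) ≡ (x , bs)
decode-encodeℕ zero    {zero} bs _ = refl
decode-encodeℕ zero    {suc x} bs (s≤s ())
decode-encodeℕ (suc ℓ) {x} bs x< with 2 ^ ℓ ≤? x
... | no  ≰x rewrite decode-encodeℕ ℓ bs (≰⇒> ≰x) = refl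
... | yes ≤x rewrite decode-encodeℕ ℓ bs (upper-half ℓ ≤x x<) = cong (_, bs) (m+[n∸m]≡n ≤x)

encode : ℕ → List ℕ → List Bool
encode ℓ = List.concatMap (encodeℕ ℓ)

length-encode : ∀ ℓ xs → List.length (encode ℓ xs) ≡ List.length xs * ℓ
length-encode ℓ []       = refl
length-encode ℓ (x ∷ xs) = trans (length-++ (encodeℕ ℓ x))
  (cong₂ _+_ (length-encodeℕ ℓ x) (length-encode ℓ xs))

-- The number of entries is not transmitted: decoding stops when the bits run out, which detects the
-- end because blocks are used with positive width. `M` only caps the number of blocks.
decode : ℕ → ℕ → List Bool → List ℕ
decode ℓ zero    _          = []
decode ℓ (suc M) []         = []
decode ℓ (suc M) bs@(_ ∷ _) = let x , rest = decodeℕ ℓ bs in x ∷ decode ℓ M rest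

decode-step : ∀ ℓ M b bs {x rest} → decodeℕ ℓ (b ∷ bs) ≡ (x , rest) →
              decode ℓ (suc M) (b ∷ bs) ≡ x ∷ decode ℓ M rest
decode-step ℓ M b bs eq rewrite eq = refl

decode-encode : ∀ ℓ M {xs} → List.length xs ≤ M → All (_< 2 ^ suc ℓ) xs →
                decode (suc ℓ) M (encode (suc ℓ) xs) ≡ xs
decode-encode ℓ zero    {[]}     _       []         = refl
decode-encode ℓ (suc M) {[]}     _       []         = refl
decode-encode ℓ (suc M) {x ∷ xs} (s≤s ≤M) (x< ∷ xs<)
  with encodeℕ (suc ℓ) x | length-encodeℕ (suc ℓ) x | decode-encodeℕ (suc ℓ) (encode (suc ℓ) xs) x<
... | b ∷ bs | _ | eq = trans (decode-step (suc ℓ) M b (bs ++ encode (suc ℓ) xs) eq) (cong (x ∷_) (decode-encode ℓ M ≤M xs<))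

nth : ∀ {A : Set} → List A → ℕ → Maybe A
nth xs i = List.head (List.drop i xs)

∈⇒nth : ∀ {A : Set} {x} {xs : List A} → x ∈ˡ xs → ∃[ i ] i < List.length xs × nth xs i ≡ just x
∈⇒nth (here refl) = zero , s≤s z≤n , refl
∈⇒nth (there x∈)  = let i , i< , eq = ∈⇒nth x∈ in suc i , s≤s i< , eq

nth-length : ∀ {A : Set} (xs : List A) → nth xs (List.length xs) ≡ nothing
nth-length []       = refl
nth-length (_ ∷ xs) = nth-length xs

-- The null pointer is encoded by the first index out of range.
indices : ∀ {A : Set} (xs : List A) {ps} → All (Maybe.All (_∈ˡ xs)) ps →
  ∃[ is ] List.map (nth xs) is ≡ ps × List.length is ≡ List.length ps × All (_≤ List.length xs) is
indices xs [] = [] , refl , refl , []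
indices xs (just x∈ ∷ ps) =
  let i , i< , eq = ∈⇒nth x∈ ; is , eqs , len , is≤ = indices xs ps
  in i ∷ is , cong₂ _∷_ eq eqs , cong suc len , <⇒≤ i< ∷ is≤
indices xs (nothing ∷ ps) =
  let is , eqs , len , is≤ = indices xs ps
  in List.length xs ∷ is , cong₂ _∷_ (nth-length xs) eqs , cong suc len , ≤-refl ∷ is≤

∈-catMaybes : ∀ {A : Set} {x : A} {ms} → just x ∈ˡ ms → x ∈ˡ catMaybes ms
∈-catMaybes {ms = just _ ∷ _}  (here refl) = here refl
∈-catMaybes {ms = just _ ∷ _}  (there x∈)  = there (∈-catMaybes x∈)
∈-catMaybes {ms = nothing ∷ _} (there x∈)  = ∈-catMaybes x∈

all-pointers : ∀ {A : Set} {P : Pred A 0ℓ} ms → (∀ {x} → just x ∈ˡ ms → P x) → All (Maybe.All P) ms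
all-pointers []             f = []
all-pointers (just _ ∷ ms)  f = just (f (here refl)) ∷ all-pointers ms (f ∘ there)
all-pointers (nothing ∷ ms) f = nothing ∷ all-pointers ms (f ∘ there)

All-zip-map⁺ : ∀ {A B : Set} {P : Pred (A × B) 0ℓ} (f : A → B) xs → (∀ x → P (x , f x)) →
               All P (zip xs (List.map f xs))
All-zip-map⁺ f []       _ = []
All-zip-map⁺ f (x ∷ xs) p = p x ∷ All-zip-map⁺ f xs p

All-zip-map⁻ : ∀ {A B : Set} {P : Pred (A × B) 0ℓ} (f : A → B) {xs x} →
               All P (zip xs (List.map f xs)) → x ∈ˡ xs → P (x , f x)
All-zip-map⁻ f (p ∷ _)  (here refl) = p
All-zip-map⁻ f (_ ∷ ps) (there x∈)  = All-zip-map⁻ f ps x∈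

Greatest : ∀ {A : Set} → Rel A 0ℓ → List A → Set
Greatest {A} _≲_ xs = Σ (Maybe A) λ m → Maybe.All (_∈ˡ xs) m × (∀ {x} → x ∈ˡ xs → ∃[ y ] m ≡ just y × x ≲ y)

module _ {A : Set} {_≲_ : Rel A 0ℓ} (total : Total _≲_) (≲-trans : Transitive _≲_) where

  ≲-refl : ∀ {x} → x ≲ x
  ≲-refl {x} with total x x
  ... | inj₁ r = r
  ... | inj₂ r = r

  greatest : ∀ xs → Greatest _≲_ xs
  greatest []       = nothing , nothing , λ ()
  greatest (x ∷ xs) with greatest xs
  ... | nothing , _ , max = just x , just (here refl) , λ
    { (here refl) → x , refl , ≲-refl
    ; (there y∈)  → case max y∈ of λ () }
  ... | just y , just y∈ , max with total x y
  ...   | inj₁ x≲y = just y , just (there y∈) , λ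
    { (here refl) → y , refl , x≲y
    ; (there z∈)  → max z∈ }
  ...   | inj₂ y≲x = just x , just (here refl) , λ
    { (here refl) → x , refl , ≲-refl
    ; (there z∈)  → case max z∈ of λ { (_ , refl , z≲y) → x , refl , ≲-trans z≲y y≲x } }

-- The compression scheme

record Reading (n : ℕ) : Set where
  constructor reading
  field
    outer inner : Tree n
    barrier     : List (Fin n)
    targets     : List (Pointer n)

read : ∀ {n} → Tree n → List (Pointer n) → Reading n
read root (u₁ ∷ u₂ ∷ side ∷ v₁ ∷ v₂ ∷ σ) = reading d (core d v₁ v₂) (W ++ separator (core d v₁ v₂)) σ
  where
  d = proj₁ (below root u₁ u₂ side)
  W = proj₂ (below root u₁ u₂ side)
-- Too short a message gives an empty region, so nothing fits and `select` falls back on the empty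
-- ball.
read root _ = reading leaf leaf [] []

module Decoder {n : ℕ} (G : Graph n) (root : Tree n) where

  Covers : Fin n → ℕ → Pred (Fin n × Pointer n) 0ℓ
  Covers c k (w , p) = Maybe.All (λ p → dist G c w + dist G w p < k) p

  -- The test refers only to data available after compression: the message and the negative points
  -- `N` that were kept.
  Fits : List (Pointer n) → Subset n → Fin n → ℕ → Set
  Fits msg N c k = Between outer inner c × (All (Covers c k) (zip barrier targets) ×
                   (∀ v → v ∈ N → ¬ dist G c v < k))
    where open Reading (read root msg)

  fits? : ∀ msg N c k → Dec (Fits msg N c k)
  fits? msg N c k = between? outer inner c
    ×-dec (All.all? (λ (w , p) → Maybe.dec (λ p → dist G c w + dist G w p <? k) p) (zip barrier targets)
    ×-dec all? λ v → (v ∈? N) →-dec ¬? (dist G c v <? k))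
    where open Reading (read root msg)

  Fitting : List (Pointer n) → Subset n → Set
  Fitting msg N = ∃[ c ] Σ (Fin (suc (suc n))) λ k → Fits msg N c (toℕ k)

  fitting? : ∀ msg N → Dec (Fitting msg N)
  fitting? msg N = any? λ c → any? λ k → fits? msg N c (toℕ k)

  select : List (Pointer n) → Subset n → Subset n
  select msg N with fitting? msg N
  ... | yes (c , k , _) = ball G c (toℕ k)
  ... | no  _           = ⊥

  select-ball : Fin n → ∀ msg N → balls G (select msg N)
  select-ball c₀ msg N with fitting? msg N
  ... | yes (c , k , _) = ball-isBall G c (s≤s⁻¹ (toℕ<n k))
  -- The fallback is the ball of radius -1, centred at `c₀` because even an empty ball needs a
  -- centre.
  ... | no  _ = c₀ , -[1+ 0 ] , λ v → mk⇔ (λ v∈ → contradiction v∈ ∉⊥) (λ { (_ , _ , ()) })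

  -- The search may return a pair other than the encoder's, so separation is demanded of every
  -- fitting pair.
  select-realizes : ∀ {msg N P Q} → Fitting msg N →
    (∀ c k → k ≤ suc n → Fits msg N c k → Separates G c k P Q) → Realizes (select msg N) P Q
  select-realizes {msg} {N} fitting sep with fitting? msg N
  ... | yes (c , k , fits) = separates⇒realizes G (sep c (toℕ k) (s≤s⁻¹ (toℕ<n k)) fits)
  ... | no  ¬fitting       = contradiction fitting ¬fitting

module Encoder {n : ℕ} (G : Graph n) {s : ℕ} (root : Tree n) (P N : Subset n)
               {c : Fin n} {k : ℕ} (located : Located G s root (elements (P ∪ N)) c)
               (k≤ : k ≤ suc n) (near : ∀ {v} → v ∈ P → dist G c v < k)
               (far : ∀ {v} → v ∈ N → ¬ dist G c v < k) where

  open Decoder G root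
  open Located located

  covered? : ∀ w → Decidable (λ p → dist G c w + dist G w p < k)
  covered? w p = dist G c w + dist G w p <? k

  farthest : ∀ w → Greatest (λ p q → dist G w p ≤ dist G w q) (filter (covered? w) (elements P))
  farthest w = greatest (λ p q → ≤-total _ _) ≤-trans _

  nearest : ∀ w → Greatest (λ p q → dist G w q ≤ dist G w p) (elements N)
  nearest w = greatest (λ p q → ≤-total _ _) (λ p≤ q≤ → ≤-trans q≤ p≤) _

  -- Only `message` is written in bits. The nearest negative points need merely be kept, since the
  -- decoder avoids all kept negative points without knowing which `w` each one serves.
  message evidence : List (Pointer n)
  message  = u₁ ∷ u₂ ∷ side ∷ v₁ ∷ v₂ ∷ List.map (proj₁ ∘ farthest) S
  evidence = message ++ List.map (proj₁ ∘ nearest) S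

  evidence-list : List (Fin n)
  evidence-list = catMaybes evidence

  kept : Subset n
  kept = fromList evidence-list

  -- Five pointers name the region, and each of the at most `s + s` vertices of `S` contributes one
  -- positive and one negative point.
  kept-small : ∣ kept ∣ ≤ 5 + ((s + s) + (s + s))
  kept-small = ≤-trans (∣fromList∣≤length evidence-list) (≤-trans (length-catMaybes evidence)
    (≤-trans (≤-reflexive (cong (λ j → 5 + j) (trans (length-++ (List.map (proj₁ ∘ farthest) S))
       (cong₂ _+_ (length-map (proj₁ ∘ farthest) S) (length-map (proj₁ ∘ nearest) S)))))
       (+-monoʳ-≤ 5 (+-mono-≤ small small))))

  message-length : List.length message ≤ 5 + (s + s)
  message-length = +-monoʳ-≤ 5 (≤-trans (≤-reflexive (length-map (proj₁ ∘ farthest) S)) small)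

  from-farthest : ∀ w → Maybe.All (λ p → p ∈ P × dist G c w + dist G w p < k) (proj₁ (farthest w))
  from-farthest w = Maybe.map (λ p∈ → let p∈P , p< = ∈-filter⁻ (covered? w) {xs = elements P} p∈
    in ∈-elements⁻ P p∈P , p<) (proj₁ (proj₂ (farthest w)))

  message-points : All (Maybe.All (_∈ P ∪ N)) message
  message-points = ++⁺ (All.map (Maybe.map (∈-elements⁻ (P ∪ N))) pointers)
    (map⁺ (All.universal (λ w → Maybe.map (p⊆p∪q N ∘ proj₁) (from-farthest w)) S))

  -- Every pointer of the message survives in the compressed sample, so it can be sent as an index
  -- into that sample.
  kept-points : All (Maybe.All (_∈ˡ elements (P ∩ kept ∪ N ∩ kept))) message
  kept-points = all-pointers message λ {v} v∈ →
    let v∈kept = ∈-fromList (∈-catMaybes {ms = evidence} (∈-++⁺ˡ v∈))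
    in ∈-elements⁺ (x∈p∪q⁺ (case x∈p∪q⁻ P N (Maybe.drop-just (All.lookup message-points v∈)) of λ
      { (inj₁ v∈P) → inj₁ (x∈p∩q⁺ (v∈P , v∈kept))
      ; (inj₂ v∈N) → inj₂ (x∈p∩q⁺ (v∈N , v∈kept)) }))

  -- The original centre and radius pass the test, so the decoder's search succeeds.
  fits : Fits message (N ∩ kept) c k
  fits = centre
    , All-zip-map⁺ (proj₁ ∘ farthest) S (λ w → Maybe.map proj₂ (from-farthest w))
    , λ v v∈ → far (p∩q⊆p N kept v∈)

  nearest-kept : ∀ {w q} → w ∈ˡ S → q ∈ N → ∃[ r ] r ∈ N ∩ kept × dist G w r ≤ dist G w q
  nearest-kept {w} w∈S q∈ =
    let r , eq , r≤q = proj₂ (proj₂ (nearest w)) (∈-elements⁺ q∈)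
        r∈N    = Maybe.drop-just (subst (Maybe.All _) eq (proj₁ (proj₂ (nearest w))))
        r∈kept = subst (_∈ˡ List.map (proj₁ ∘ nearest) S) eq (∈-map⁺ (proj₁ ∘ nearest) w∈S)
    in r , x∈p∩q⁺ (∈-elements⁻ N r∈N , ∈-fromList (∈-catMaybes {ms = evidence} (∈-++⁺ʳ message r∈kept))) , r≤q

  fits⇒covers : ∀ {c′ k′ w} → Fits message (N ∩ kept) c′ k′ → w ∈ˡ S → Covers c′ k′ (w , proj₁ (farthest w))
  fits⇒covers (_ , covers , _) = All-zip-map⁻ (proj₁ ∘ farthest) {xs = S} covers

  fits⇒separates : ∀ c′ k′ → k′ ≤ suc n → Fits message (N ∩ kept) c′ k′ → Separates G c′ k′ P N
  fits⇒separates c′ k′ k′≤ fits′@(centre′ , _ , misses) = near′ , far′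
    where
    near′ : ∀ {p} → p ∈ P → dist G c′ p < k′
    -- The crossing vertex `w` comes from the original ball: `p` is reached through `w` within `k`,
    -- so it competes for the farthest point of `w`.
    near′ {p} p∈ with dist-meets G closed centre (caught (∈-elements⁺ (p⊆p∪q N p∈))) k≤ (near p∈)
    ... | w , w∈S , p< with proj₂ (proj₂ (farthest w)) (∈-filter⁺ (covered? w) (∈-elements⁺ p∈) p<)
    ...   | q , eq , p≤q = ≤-<-trans (≤-trans (dist-triangle G c′ w p) (+-monoʳ-≤ (dist G c′ w) p≤q))
      (Maybe.drop-just (subst (Maybe.All _) eq (fits⇒covers fits′ w∈S)))

    far′ : ∀ {q} → q ∈ N → ¬ dist G c′ q < k′
    far′ {q} q∈ q< =
      -- Now the crossing vertex comes from the new centre, which lies in the same region; the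
      -- nearest negative point `r` of `w` would then be in the new ball too.
      let w , w∈S , w< = dist-meets G closed centre′ (caught (∈-elements⁺ (q⊆p∪q P N q∈))) k′≤ q<
          r , r∈ , r≤q = nearest-kept w∈S q∈
      in misses r r∈ (≤-<-trans (≤-trans (dist-triangle G c′ w r) (+-monoʳ-≤ (dist G c′ w) r≤q)) w<)

-- Otherwise monotonicity of the logarithm would make it exceed itself.
n<2^[1+⌊log₂n⌋] : ∀ n → n < 2 ^ suc ⌊log₂ n ⌋
n<2^[1+⌊log₂n⌋] n = ≰⇒> λ 2^≤n →
  <-irrefl refl (≤-trans (≤-reflexive (sym (⌊log₂[2^n]⌋≡n (suc ⌊log₂ n ⌋)))) (⌊log₂⌋-mono-≤ 2^≤n))

-- The hyperedge of a sample is irrelevant and cannot supply the centre and radius. These are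
-- recomputed by finite search, and irrelevance is harmless when refuting a failed search.
separable : ∀ {n} {G : Graph n} (X : Sample (balls G)) → Separable G (pos X) (neg X)
separable {G = G} (sample P N realizable) with separable? G P N
... | yes sep = sep
... | no ¬sep = ⊥-elim-irr (¬sep (realizable⇒separable G realizable))

-- A sample presupposes a ball and a ball has a centre, so the empty graph has no samples. This
-- supplies the centre of the fallback ball.
vertex : ∀ {n} {G : Graph n} → Sample (balls G) → Fin n
vertex {zero}  (sample _ _ realizable) = ⊥-elim-irr (no-balls realizable)
  where
  no-balls : ∀ {G : Graph 0} {P N} → ¬ (∃[ e ] balls G e × Realizes e P N)
  no-balls (_ , (() , _) , _)
vertex {suc n} _ = zero

restrict : ∀ {n} {G : Graph n} → Sample (balls G) → Subset n → Sample (balls G)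
restrict (sample P N realizable) Y = sample (P ∩ Y) (N ∩ Y) (weaken realizable)
  where
  weaken : ∃[ e ] balls _ e × Realizes e P N → ∃[ e ] balls _ e × Realizes e (P ∩ Y) (N ∩ Y)
  weaken (e , isBall , P⊆e , e∩N) = e , isBall , P⊆e ∘ p∩q⊆p P Y
    , λ (v , v∈) → let v∈e , v∈N = x∈p∩q⁻ e (N ∩ Y) v∈ in e∩N (v , x∈p∩q⁺ (v∈e , p∩q⊆p N Y v∈N))

restrict-size : ∀ {n} {G : Graph n} (X : Sample (balls G)) Y → sampleSize (restrict X Y) ≤ ∣ Y ∣
restrict-size (sample P N _) Y = p⊆q⇒∣p∣≤∣q∣ λ v∈ → case x∈p∪q⁻ (P ∩ Y) (N ∩ Y) v∈ of λ
  { (inj₁ v∈) → p∩q⊆q P Y v∈ ; (inj₂ v∈) → p∩q⊆q N Y v∈ }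

-- The separation `root` is fixed with `G`, so both maps share it without transmitting it. The bound
-- `enough` leaves room for the null index, one past the last kept point.
module Scheme {n : ℕ} (G : Graph n) (s ℓ : ℕ) (root : Tree n) (valid : Valid G s root)
              (full : ∀ v → v ∈ support root)
              (enough : 5 + ((s + s) + (s + s)) < 2 ^ suc ℓ) where

  open Decoder G root

  module Encoded (X : Sample (balls G)) where
    c = proj₁ (separable X)
    k = proj₁ (proj₂ (separable X))

    open Encoder G {s} root (pos X) (neg X) {c} {toℕ k}
      (locate G s root (elements (pos X ∪ neg X)) c valid full)
      (s≤s⁻¹ (toℕ<n k)) (proj₁ (proj₂ (proj₂ (separable X)))) (proj₂ (proj₂ (proj₂ (separable X)))) public

    Y : Sample (balls G)
    Y = restrict X kept

    Y-size : sampleSize Y ≤ 5 + ((s + s) + (s + s))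
    Y-size = ≤-trans (restrict-size X kept) kept-small

    index = indices (elements (pos Y ∪ neg Y)) kept-points

  κ : Sample (balls G) → Sample (balls G) × List Bool
  κ X = Y , encode (suc ℓ) (proj₁ index)
    where open Encoded X

  pointers-of : Sample (balls G) → List Bool → List (Pointer n)
  pointers-of Y bits = List.map (nth (elements (pos Y ∪ neg Y))) (decode (suc ℓ) (5 + (s + s)) bits)

  ρ : Sample (balls G) × List Bool → Subset n
  ρ (Y , bits) = select (pointers-of Y bits) (neg Y)

  module _ (X : Sample (balls G)) where
    open Encoded X

    recovered : pointers-of Y (proj₂ (κ X)) ≡ message
    recovered = trans
      (cong (List.map (nth (elements (pos Y ∪ neg Y))))
        (decode-encode ℓ (5 + (s + s))
          (≤-trans (≤-reflexive (proj₁ (proj₂ (proj₂ index)))) message-length)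
          (All.map (λ i≤ → ≤-<-trans i≤ (≤-<-trans (≤-trans (≤-reflexive (length-elements (pos Y ∪ neg Y))) Y-size) enough))
            (proj₂ (proj₂ (proj₂ index))))))
      (proj₁ (proj₂ index))

    bits-length : List.length (proj₂ (κ X)) ≤ (5 + (s + s)) * suc ℓ
    bits-length = ≤-trans (≤-reflexive (length-encode (suc ℓ) (proj₁ index)))
      (*-monoˡ-≤ (suc ℓ) (≤-trans (≤-reflexive (proj₁ (proj₂ (proj₂ index)))) message-length))

    realizes : Realizes (ρ (κ X)) (pos X) (neg X)
    realizes = select-realizes (subst (λ msg → Fitting msg (neg Y)) (sym recovered) (c , k , fits))
      λ c′ k′ k′≤ fits′ → fits⇒separates c′ k′ k′≤ (subst (λ msg → Fits msg (neg Y) c′ k′) recovered fits′)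

  scheme : CompressionScheme (balls G)
  scheme = record
    { κ         = κ
    ; ρ         = ρ
    ; subsample = λ X → let open Encoded X in p∩q⊆p (pos X) kept , p∩q⊆p (neg X) kept
    ; realizes  = realizes
    }

  proper : Proper scheme
  proper (Y , bits) = select-ball (vertex Y) (pointers-of Y bits) (neg Y)

  scheme-size : ∀ {b} → 5 + ((s + s) + (s + s)) + (5 + (s + s)) * suc ℓ ≤ b → SizeAtMost scheme b
  scheme-size ≤b = _ , _ , (λ X → Encoded.Y-size X) , bits-length , ≤b

-- Arithmetic of the size bound

enough-bits : ∀ t → 5 + ((suc t + suc t) + (suc t + suc t)) < 2 ^ suc (3 + ⌊log₂ (t + 1) ⌋)
enough-bits t = begin
  -- The slack `4 * t + 6` rounds `4 * t + 10` up to `8 * (t + 2)`; the factor 8 accounts for three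
  -- extra bits.
  suc (5 + ((suc t + suc t) + (suc t + suc t)))                ≤⟨ m≤m+n _ (4 * t + 6) ⟩
  suc (5 + ((suc t + suc t) + (suc t + suc t))) + (4 * t + 6)  ≡⟨ expand t ⟩
  8 * suc (t + 1)                                              ≤⟨ *-monoʳ-≤ 8 (n<2^[1+⌊log₂n⌋] (t + 1)) ⟩
  8 * 2 ^ suc ⌊log₂ (t + 1) ⌋                                  ≡⟨ ^-distribˡ-+-* 2 3 (suc ⌊log₂ (t + 1) ⌋) ⟨
  2 ^ suc (3 + ⌊log₂ (t + 1) ⌋)                                ∎
  where
  open ≤-Reasoning
  expand : ∀ t → suc (5 + ((suc t + suc t) + (suc t + suc t))) + (4 * t + 6) ≡ 8 * suc (t + 1)
  expand = solve-∀

-- The left side is `37 + 12 * t + 7 * L + 2 * (t * L)`. As `t` and `L` are at least 1, each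
-- monomial is at most `t * L`, and 58 is the sum of the coefficients.
size-bound : ∀ {t L} → 0 < t → 0 < L → let s = suc t in
  5 + ((s + s) + (s + s)) + (5 + (s + s)) * suc (3 + L) ≤ 58 * (t * L)
size-bound {suc t} {suc L} _ _ = ≤-trans (m≤m+n _ (44 * t + 49 * L + 56 * (t * L))) (≤-reflexive (expand t L))
  where
  expand : ∀ t L → let s = suc (suc t) in
    5 + ((s + s) + (s + s)) + (5 + (s + s)) * suc (3 + suc L) + (44 * t + 49 * L + 56 * (t * L))
    ≡ 58 * (suc t * suc L)
  expand = solve-∀

theorem1p1 : ∃[ C ] 0 < C × (∀ (t : ℕ) → 0 < t → ∀ {n : ℕ} (G : Graph n) →
    TreewidthAtMost G t →
    Σ (CompressionScheme (balls G)) λ 𝒞 →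
    Proper 𝒞 × SizeAtMost 𝒞 (C * (t * ⌊log₂ (t + 1) ⌋)))
theorem1p1 = 58 , s≤s z≤n , λ t 0<t G (𝒟 , bag≤) →
  let root , valid , full = separation-tree 𝒟 bag≤
      open Scheme G (suc t) (3 + ⌊log₂ (t + 1) ⌋) root valid full (enough-bits t)
  -- From `t ≥ 1` follows `t + 1 ≥ 2`, so the logarithm is at least 1 and absorbs the constant
  -- terms.
  in scheme , proper , scheme-size (size-bound 0<t (⌊log₂⌋-mono-≤ (+-monoˡ-≤ 1 0<t)))
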